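{- Let $x_1,x_2\ge 0$. If $x_1+x_2\le 5/11$, then $C_3(x_1,x_2)\le 11/6\le 2.012096$.
   Context: Let $F(z)=\min\{(11/6)z,1\}$ for $z\in[0,1]$, and let $F'(z)=11/6$ for $z\in[0,6/11]$ and $F'(z)=0$ otherwise. For $x_1,x_2,x_3\ge 0$ with $x_1+x_2+x_3=1$ define $$d_3(x_1,x_2,x_3)=\frac{1}{3!}\sum_{\sigma}\Big(F'(x_1)\prod_{i:\sigma(i)<\sigma(1)}[1-F(x_i)]+F'(x_2)\prod_{i:\sigma(i)<\sigma(2)}[1-F(x_i)]\Big),$$ the sum being over all permutations $\sigma$ of $\{1,2,3\}$, and define $C_3(x_1,x_2)=d_3(x_1,x_2,1-x_1-x_2)$. -}

module Defs where

open import Data.Fin.Base using (Fin; zero; suc; punchIn)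
open import Data.Fin.Patterns using (0F; 1F)
open import Data.Fin.Permutation using (Permutation′; _⟨$⟩ʳ_; _≈_; id; insert; remove; insert-punchIn; insert-remove)
open import Data.Fin.Properties using (_<?_)
open import Data.Integer.Base using (+_)
open import Data.List.Base using (List; []; _∷_; [_]; map; foldr; filter; allFin; length; cartesianProductWith)
open import Data.List.Membership.Propositional.Properties using (∈-allFin)
open import Data.List.Relation.Unary.Any using (Any; here)
open import Data.List.Relation.Unary.Any.Properties using (cartesianProductWith⁺)
open import Data.Nat.Base as ℕ using (ℕ)
import Data.Nat.Properties as ℕ
open import Data.Product.Base using (∃; _×_; _,_)
open import Data.Rational.Base as ℚ using (ℚ; 0ℚ; 1ℚ; ½; ∣_∣; _/_; positive)
import Data.Rational.Properties as ℚ
open import Data.Rational.Solver using (module +-*-Solver)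
open import Data.Sum.Base using (inj₁; inj₂)
open import Data.Vec.Functional using (Vector) renaming ([] to []ᵛ; _∷_ to _∷ᵛ_)
open import Relation.Binary.PropositionalEquality using (_≡_; refl; sym; trans; cong; cong₂; subst)
open import Relation.Nullary using (Dec; yes; no)

-- Real numbers are Cauchy sequences of rationals with pointwise operations.
-- Two reals x and y are equal when x ≤ y and y ≤ x for the order defined below.

IsCauchy : (ℕ → ℚ) → Set
IsCauchy s = ∀ ε → 0ℚ ℚ.< ε →
  ∃ λ N → ∀ m n → N ℕ.≤ m → N ℕ.≤ n → ∣ s m ℚ.- s n ∣ ℚ.< ε

record ℝ : Set where
  constructor mkℝ
  field
    seq    : ℕ → ℚ
    cauchy : IsCauchy seq

open ℝ public

infix 4 _≤_

_≤_ : ℝ → ℝ → Set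
x ≤ y = ∀ ε → 0ℚ ℚ.< ε → ∃ λ N → ∀ n → N ℕ.≤ n → seq x n ℚ.≤ seq y n ℚ.+ ε

private
  open ℚ.≤-Reasoning
  open +-*-Solver

  halves : ∀ ε → ε ℚ.* ½ ℚ.+ ε ℚ.* ½ ≡ ε
  halves ε = trans (sym (ℚ.*-distribˡ-+ ε ½ ½)) (ℚ.*-identityʳ ε)

  *-pos : ∀ {p q} → 0ℚ ℚ.< p → 0ℚ ℚ.< q → 0ℚ ℚ.< p ℚ.* q
  *-pos {p} {q} 0<p 0<q = ℚ.positive⁻¹ (p ℚ.* q) ⦃ ℚ.pos*pos⇒pos p ⦃ positive 0<p ⦄ q ⦃ positive 0<q ⦄ ⦄

  half-pos : ∀ {ε} → 0ℚ ℚ.< ε → 0ℚ ℚ.< ε ℚ.* ½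
  half-pos 0<ε = *-pos 0<ε (ℚ.positive⁻¹ ½)

  p≤∣p∣ : ∀ p → p ℚ.≤ ∣ p ∣
  p≤∣p∣ p with ℚ.≤-total 0ℚ p
  ... | inj₁ 0≤p = ℚ.≤-reflexive (sym (ℚ.0≤p⇒∣p∣≡p 0≤p))
  ... | inj₂ p≤0 = ℚ.≤-trans p≤0 (ℚ.0≤∣p∣ p)

  ∣p-q∣≡∣q-p∣ : ∀ p q → ∣ p ℚ.- q ∣ ≡ ∣ q ℚ.- p ∣
  ∣p-q∣≡∣q-p∣ p q = trans (cong ∣_∣ (solve 2 (λ p q → p :- q := :- (q :- p)) refl p q)) (ℚ.∣-p∣≡∣p∣ (q ℚ.- p))

  close⇒< : ∀ p q {ε} → ∣ p ℚ.- q ∣ ℚ.< ε → p ℚ.< q ℚ.+ ε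
  close⇒< p q {ε} h = begin-strict
    p                  ≡⟨ solve 2 (λ p q → p := q :+ (p :- q)) refl p q ⟩
    q ℚ.+ (p ℚ.- q)    ≤⟨ ℚ.+-monoʳ-≤ q (p≤∣p∣ (p ℚ.- q)) ⟩
    q ℚ.+ ∣ p ℚ.- q ∣  <⟨ ℚ.+-monoʳ-< q h ⟩
    q ℚ.+ ε            ∎

  <⇒diff< : ∀ p q {ε} → p ℚ.< q ℚ.+ ε → p ℚ.- q ℚ.< ε
  <⇒diff< p q {ε} h = begin-strict
    p ℚ.- q          <⟨ ℚ.+-monoˡ-< (ℚ.- q) h ⟩
    q ℚ.+ ε ℚ.- q    ≡⟨ solve 2 (λ q ε → q :+ ε :- q := ε) refl q ε ⟩
    ε                ∎

  <⇒close : ∀ p q {ε} → p ℚ.< q ℚ.+ ε → q ℚ.< p ℚ.+ ε → ∣ p ℚ.- q ∣ ℚ.< ε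
  <⇒close p q h k with ℚ.∣p∣≡p∨∣p∣≡-p (p ℚ.- q)
  ... | inj₁ e = subst (ℚ._< _) (sym e) (<⇒diff< p q h)
  ... | inj₂ e = subst (ℚ._< _)
    (sym (trans e (solve 2 (λ p q → :- (p :- q) := q :- p) refl p q))) (<⇒diff< q p k)

  ⊓-< : ∀ a b c d {ε} → a ℚ.< c ℚ.+ ε → b ℚ.< d ℚ.+ ε → a ℚ.⊓ b ℚ.< c ℚ.⊓ d ℚ.+ ε
  ⊓-< a b c d h k with ℚ.⊓-sel c d
  ... | inj₁ e rewrite e = ℚ.≤-<-trans (ℚ.p⊓q≤p a b) h
  ... | inj₂ e rewrite e = ℚ.≤-<-trans (ℚ.p⊓q≤q a b) k

  ⊓-close : ∀ a b c d {ε} → ∣ a ℚ.- c ∣ ℚ.< ε → ∣ b ℚ.- d ∣ ℚ.< ε → ∣ a ℚ.⊓ b ℚ.- c ℚ.⊓ d ∣ ℚ.< ε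
  ⊓-close a b c d {ε} h k = <⇒close (a ℚ.⊓ b) (c ℚ.⊓ d)
    (⊓-< a b c d (close⇒< a c h) (close⇒< b d k))
    (⊓-< c d a b (close⇒< c a (subst (ℚ._< ε) (∣p-q∣≡∣q-p∣ a c) h))
                 (close⇒< d b (subst (ℚ._< ε) (∣p-q∣≡∣q-p∣ b d) k)))

  +-close : ∀ a b c d {δ η} → ∣ a ℚ.- c ∣ ℚ.< δ → ∣ b ℚ.- d ∣ ℚ.< η →
            ∣ (a ℚ.+ b) ℚ.- (c ℚ.+ d) ∣ ℚ.< δ ℚ.+ η
  +-close a b c d {δ} {η} h k = begin-strict
    ∣ (a ℚ.+ b) ℚ.- (c ℚ.+ d) ∣    ≡⟨ cong ∣_∣ (solve 4 (λ a b c d → (a :+ b) :- (c :+ d) := (a :- c) :+ (b :- d)) refl a b c d) ⟩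
    ∣ (a ℚ.- c) ℚ.+ (b ℚ.- d) ∣    ≤⟨ ℚ.∣p+q∣≤∣p∣+∣q∣ (a ℚ.- c) (b ℚ.- d) ⟩
    ∣ a ℚ.- c ∣ ℚ.+ ∣ b ℚ.- d ∣    <⟨ ℚ.+-mono-< h k ⟩
    δ ℚ.+ η                        ∎

  ∣*∣-< : ∀ p q {K δ} → 0ℚ ℚ.< K → ∣ p ∣ ℚ.< K → ∣ q ∣ ℚ.< δ → ∣ p ℚ.* q ∣ ℚ.< K ℚ.* δ
  ∣*∣-< p q {K} {δ} 0<K h k = begin-strict
    ∣ p ℚ.* q ∣      ≡⟨ ℚ.∣p*q∣≡∣p∣*∣q∣ p q ⟩
    ∣ p ∣ ℚ.* ∣ q ∣  ≤⟨ ℚ.*-monoʳ-≤-nonNeg ∣ q ∣ ⦃ ℚ.∣-∣-nonNeg q ⦄ (ℚ.<⇒≤ h) ⟩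
    K ℚ.* ∣ q ∣      <⟨ ℚ.*-monoʳ-<-pos K ⦃ positive 0<K ⦄ k ⟩
    K ℚ.* δ          ∎

  *-close : ∀ a b c d {K L δ η} → 0ℚ ℚ.< K → 0ℚ ℚ.< L → ∣ a ∣ ℚ.< K → ∣ d ∣ ℚ.< L →
            ∣ a ℚ.- c ∣ ℚ.< δ → ∣ b ℚ.- d ∣ ℚ.< η →
            ∣ a ℚ.* b ℚ.- c ℚ.* d ∣ ℚ.< K ℚ.* η ℚ.+ L ℚ.* δ
  *-close a b c d {K} {L} {δ} {η} 0<K 0<L a<K d<L h k = begin-strict
    ∣ a ℚ.* b ℚ.- c ℚ.* d ∣                          ≡⟨ cong ∣_∣ (solve 4 (λ a b c d → a :* b :- c :* d := a :* (b :- d) :+ d :* (a :- c)) refl a b c d) ⟩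
    ∣ a ℚ.* (b ℚ.- d) ℚ.+ d ℚ.* (a ℚ.- c) ∣          ≤⟨ ℚ.∣p+q∣≤∣p∣+∣q∣ (a ℚ.* (b ℚ.- d)) (d ℚ.* (a ℚ.- c)) ⟩
    ∣ a ℚ.* (b ℚ.- d) ∣ ℚ.+ ∣ d ℚ.* (a ℚ.- c) ∣      <⟨ ℚ.+-mono-< (∣*∣-< a (b ℚ.- d) 0<K a<K k) (∣*∣-< d (a ℚ.- c) 0<L d<L h) ⟩
    K ℚ.* η ℚ.+ L ℚ.* δ                              ∎

  bounded : ∀ x → ∃ λ K → 0ℚ ℚ.< K × ∃ λ N → ∀ n → N ℕ.≤ n → ∣ seq x n ∣ ℚ.< K
  bounded x with cauchy x 1ℚ (ℚ.positive⁻¹ 1ℚ)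
  ... | N , close = K , 0<K , N , bound
    where
    s = seq x
    K = ∣ s N ∣ ℚ.+ 1ℚ
    0<K : 0ℚ ℚ.< K
    0<K = ℚ.+-mono-≤-< (ℚ.0≤∣p∣ (s N)) (ℚ.positive⁻¹ 1ℚ)
    bound : ∀ n → N ℕ.≤ n → ∣ s n ∣ ℚ.< K
    bound n N≤n = begin-strict
      ∣ s n ∣                          ≡⟨ cong ∣_∣ (solve 2 (λ p q → p := q :+ (p :- q)) refl (s n) (s N)) ⟩
      ∣ s N ℚ.+ (s n ℚ.- s N) ∣        ≤⟨ ℚ.∣p+q∣≤∣p∣+∣q∣ (s N) (s n ℚ.- s N) ⟩
      ∣ s N ∣ ℚ.+ ∣ s n ℚ.- s N ∣      <⟨ ℚ.+-monoʳ-< ∣ s N ∣ (close n N N≤n ℕ.≤-refl) ⟩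
      K                                ∎

  divide : ∀ K → 0ℚ ℚ.< K → ∀ {ε} → 0ℚ ℚ.< ε → ∃ λ δ → 0ℚ ℚ.< δ × K ℚ.* δ ≡ ε
  divide K 0<K {ε} 0<ε = K⁻¹ ℚ.* ε , *-pos 0<K⁻¹ 0<ε ,
    trans (sym (ℚ.*-assoc K K⁻¹ ε)) (trans (cong (ℚ._* ε) (ℚ.*-inverseʳ K)) (ℚ.*-identityˡ ε))
    where
    instance
      _ = positive 0<K
      _ = ℚ.pos⇒nonZero K
    K⁻¹ = ℚ.1/ K
    0<K⁻¹ : 0ℚ ℚ.< K⁻¹
    0<K⁻¹ = ℚ.positive⁻¹ K⁻¹ ⦃ ℚ.1/pos⇒pos K ⦄

  ⊔ˡ : ∀ {i j k} → i ℕ.⊔ j ℕ.≤ k → i ℕ.≤ k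
  ⊔ˡ {i} {j} = ℕ.m⊔n≤o⇒m≤o i j

  ⊔ʳ : ∀ {i j k} → i ℕ.⊔ j ℕ.≤ k → j ℕ.≤ k
  ⊔ʳ {i} {j} = ℕ.m⊔n≤o⇒n≤o i j

  abstract
    +-cauchy : ∀ x y → IsCauchy λ n → seq x n ℚ.+ seq y n
    +-cauchy x y ε 0<ε
      with cauchy x (ε ℚ.* ½) (half-pos 0<ε) | cauchy y (ε ℚ.* ½) (half-pos 0<ε)
    ... | M , p | N , q = M ℕ.⊔ N , λ m n i j → subst (_ ℚ.<_) (halves ε)
      (+-close (seq x m) (seq y m) (seq x n) (seq y n) (p m n (⊔ˡ i) (⊔ˡ j)) (q m n (⊔ʳ {M} i) (⊔ʳ {M} j)))

    neg-cauchy : ∀ x → IsCauchy λ n → ℚ.- seq x n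
    neg-cauchy x ε 0<ε with cauchy x ε 0<ε
    ... | N , p = N , λ m n i j → subst (ℚ._< ε)
      (cong ∣_∣ (solve 2 (λ a b → b :- a := :- a :- (:- b)) refl (seq x m) (seq x n))) (p n m j i)

    ⊓-cauchy : ∀ x y → IsCauchy λ n → seq x n ℚ.⊓ seq y n
    ⊓-cauchy x y ε 0<ε with cauchy x ε 0<ε | cauchy y ε 0<ε
    ... | M , p | N , q = M ℕ.⊔ N , λ m n i j →
      ⊓-close (seq x m) (seq y m) (seq x n) (seq y n) (p m n (⊔ˡ i) (⊔ˡ j)) (q m n (⊔ʳ {M} i) (⊔ʳ {M} j))

    *-cauchy : ∀ x y → IsCauchy λ n → seq x n ℚ.* seq y n
    *-cauchy x y ε 0<ε =
      let K , 0<K , A , a = bounded x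
          L , 0<L , B , b = bounded y
          η , 0<η , Kη    = divide K 0<K (half-pos 0<ε)
          δ , 0<δ , Lδ    = divide L 0<L (half-pos 0<ε)
          M , p           = cauchy x δ 0<δ
          N , q           = cauchy y η 0<η
          eq              = trans (cong₂ ℚ._+_ Kη Lδ) (halves ε)
      in (A ℕ.⊔ B) ℕ.⊔ (M ℕ.⊔ N) , λ m n i j →
        subst (∣ seq x m ℚ.* seq y m ℚ.- seq x n ℚ.* seq y n ∣ ℚ.<_) eq
          (*-close (seq x m) (seq y m) (seq x n) (seq y n) 0<K 0<L
            (a m (⊔ˡ (⊔ˡ i))) (b n (⊔ʳ {A} (⊔ˡ j)))
            (p m n (⊔ˡ (⊔ʳ {A ℕ.⊔ B} i)) (⊔ˡ (⊔ʳ {A ℕ.⊔ B} j)))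
            (q m n (⊔ʳ {M} (⊔ʳ {A ℕ.⊔ B} i)) (⊔ʳ {M} (⊔ʳ {A ℕ.⊔ B} j))))

    const-cauchy : ∀ q → IsCauchy λ _ → q
    const-cauchy q ε 0<ε = 0 , λ _ _ _ _ → subst (ℚ._< ε) (cong ∣_∣ (sym (ℚ.+-inverseʳ q))) 0<ε

infixl 6 _+_ _-_
infixl 7 _*_ _⊓_
infix  8 -_

fromℚ : ℚ → ℝ
fromℚ q = mkℝ (λ _ → q) (const-cauchy q)

_+_ : ℝ → ℝ → ℝ
x + y = mkℝ (λ n → seq x n ℚ.+ seq y n) (+-cauchy x y)

-_ : ℝ → ℝ
- x = mkℝ (λ n → ℚ.- seq x n) (neg-cauchy x)

_-_ : ℝ → ℝ → ℝ
x - y = x + (- y)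

_*_ : ℝ → ℝ → ℝ
x * y = mkℝ (λ n → seq x n ℚ.* seq y n) (*-cauchy x y)

_⊓_ : ℝ → ℝ → ℝ
x ⊓ y = mkℝ (λ n → seq x n ℚ.⊓ seq y n) (⊓-cauchy x y)

0ℝ 1ℝ : ℝ
0ℝ = fromℚ 0ℚ
1ℝ = fromℚ 1ℚ

∑ ∏ : List ℝ → ℝ
∑ = foldr _+_ 0ℝ
∏ = foldr _*_ 1ℝ

permutations : ∀ n → List (Permutation′ n)
permutations ℕ.zero    = [ id ]
permutations (ℕ.suc n) = cartesianProductWith (insert 0F) (allFin (ℕ.suc n)) (permutations n)

-- The next two facts show that each permutation of Fin 3 is listed exactly once.

permutations-complete : ∀ n (π : Permutation′ n) → Any (π ≈_) (permutations n)
permutations-complete ℕ.zero    π = here λ ()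
permutations-complete (ℕ.suc n) π =
  cartesianProductWith⁺ (insert 0F) insert-cong (∈-allFin (π ⟨$⟩ʳ 0F))
    (permutations-complete n (remove 0F π))
  where
  insert-cong : ∀ {j ρ} → π ⟨$⟩ʳ 0F ≡ j → remove 0F π ≈ ρ → π ≈ insert 0F j ρ
  insert-cong {ρ = ρ} refl eq zero    = refl
  insert-cong {ρ = ρ} refl eq (suc k) = trans (sym (insert-remove 0F π (suc k)))
    (trans (insert-punchIn 0F (π ⟨$⟩ʳ 0F) (remove 0F π) k)
      (trans (cong (punchIn (π ⟨$⟩ʳ 0F)) (eq k))
        (sym (insert-punchIn 0F (π ⟨$⟩ʳ 0F) ρ k))))

length-permutations-3 : length (permutations 3) ≡ 6
length-permutations-3 = refl

F : ℝ → ℝ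
F z = fromℚ (+ 11 / 6) * z ⊓ 1ℝ

-- F′ jumps at 6/11 and the order on ℝ is not decidable constructively, so the
-- case distinction takes the answer to z ≤ 6/11 as an argument; the value does
-- not depend on which proof is supplied.
F′ : (z : ℝ) → Dec (z ≤ fromℚ (+ 6 / 11)) → ℝ
F′ z (yes _) = fromℚ (+ 11 / 6)
F′ z (no  _) = 0ℝ

∏-before : Permutation′ 3 → Fin 3 → Vector ℝ 3 → ℝ
∏-before σ k x =
  ∏ (map (λ i → 1ℝ - F (x i)) (filter (λ i → (σ ⟨$⟩ʳ i) <? (σ ⟨$⟩ʳ k)) (allFin 3)))

-- The indices 1, 2, 3 are 0F, 1F, 2F.
d₃ : (x₁ x₂ x₃ : ℝ) → Dec (x₁ ≤ fromℚ (+ 6 / 11)) → Dec (x₂ ≤ fromℚ (+ 6 / 11)) → ℝ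
d₃ x₁ x₂ x₃ x₁≤? x₂≤? = fromℚ (+ 1 / 6) *
  ∑ (map (λ σ → F′ x₁ x₁≤? * ∏-before σ 0F x + F′ x₂ x₂≤? * ∏-before σ 1F x) (permutations 3))
  where
  x : Vector ℝ 3
  x = x₁ ∷ᵛ x₂ ∷ᵛ x₃ ∷ᵛ []ᵛ

C₃ : (x₁ x₂ : ℝ) → Dec (x₁ ≤ fromℚ (+ 6 / 11)) → Dec (x₂ ≤ fromℚ (+ 6 / 11)) → ℝ
C₃ x₁ x₂ = d₃ x₁ x₂ (1ℝ - x₁ - x₂)

{-# OPTIONS --safe #-}

-- Write a, b, c for 1 − F(x₁), 1 − F(x₂), 1 − F(x₃). Among the six orders of
-- {1,2,3}, the set of indices preceding a given k is empty twice, each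
-- singleton once and the full pair twice, so
--   d₃ = (F′(x₁)(2 + b + c + 2bc) + F′(x₂)(2 + a + c + 2ac)) / 6.
-- If x₁ + x₂ ≤ 5/11 then x₃ ≥ 6/11, hence c = 0, and a, b ≤ 1 together with
-- F′ ≤ 11/6 give d₃ ≤ (11/6)(3 + 3)/6. On the approximating sequences the
-- hypotheses only hold up to some δ, which turns the bounds into
-- a, b ≤ 1 + t and 0 ≤ c ≤ t with t = (11/6)δ.
module Submission where

open import Defs
open import Data.Integer.Base using (+_)
open import Data.Nat.Base as ℕ using (ℕ)
import Data.Nat.Properties as ℕ
open import Data.Product.Base using (∃; _×_; _,_)
open import Data.Rational.Base as ℚ using (ℚ; 0ℚ; 1ℚ; _/_; nonNegative)
import Data.Rational.Properties as ℚ
open import Data.Rational.Solver using (module +-*-Solver)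
open import Data.Sum.Base using (inj₁; inj₂)
open import Relation.Binary.PropositionalEquality using (_≡_; refl; sym; subst)
open import Relation.Nullary using (Dec; yes; no)
open import Relation.Nullary.Decidable using (from-yes)

open ℚ.≤-Reasoning
open +-*-Solver

private
  2ℚ 3ℚ 5ℚ 6ℚ 11/6 : ℚ
  2ℚ   = + 2 / 1
  3ℚ   = + 3 / 1
  5ℚ   = + 5 / 1
  6ℚ   = + 6 / 1
  11/6 = + 11 / 6

  0≤11/6 : 0ℚ ℚ.≤ 11/6
  0≤11/6 = from-yes (0ℚ ℚ.≤? 11/6)

*-monoʳ-≤-0≤ : ∀ {p q r} → 0ℚ ℚ.≤ r → p ℚ.≤ q → r ℚ.* p ℚ.≤ r ℚ.* q
*-monoʳ-≤-0≤ {r = r} 0≤r = ℚ.*-monoˡ-≤-nonNeg r ⦃ nonNegative 0≤r ⦄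

*-monoˡ-≤-0≤ : ∀ {p q r} → 0ℚ ℚ.≤ r → p ℚ.≤ q → p ℚ.* r ℚ.≤ q ℚ.* r
*-monoˡ-≤-0≤ {r = r} 0≤r = ℚ.*-monoʳ-≤-nonNeg r ⦃ nonNegative 0≤r ⦄

1-Fℚ : ℚ → ℚ
1-Fℚ z = 1ℚ ℚ.- (11/6 ℚ.* z ℚ.⊓ 1ℚ)

0≤1-Fℚ : ∀ z → 0ℚ ℚ.≤ 1-Fℚ z
0≤1-Fℚ z = ℚ.+-monoʳ-≤ 1ℚ (ℚ.neg-antimono-≤ (ℚ.p⊓q≤q (11/6 ℚ.* z) 1ℚ))

1-Fℚ≤ : ∀ {z s} → 0ℚ ℚ.≤ s → 1ℚ ℚ.- s ℚ.≤ 11/6 ℚ.* z → 1-Fℚ z ℚ.≤ s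
1-Fℚ≤ {z} {s} 0≤s h = begin
  1ℚ ℚ.- (11/6 ℚ.* z ℚ.⊓ 1ℚ)  ≤⟨ ℚ.+-monoʳ-≤ 1ℚ (ℚ.neg-antimono-≤ (ℚ.⊓-glb h 1-s≤1)) ⟩
  1ℚ ℚ.- (1ℚ ℚ.- s)           ≡⟨ solve 1 (λ s → con 1ℚ :- (con 1ℚ :- s) := s) refl s ⟩
  s                           ∎
  where
  1-s≤1 : 1ℚ ℚ.- s ℚ.≤ 1ℚ
  1-s≤1 = ℚ.+-monoʳ-≤ 1ℚ (ℚ.neg-antimono-≤ 0≤s)

1-Fℚ≤1+ : ∀ {z δ} → 0ℚ ℚ.≤ δ → 0ℚ ℚ.≤ z ℚ.+ δ → 1-Fℚ z ℚ.≤ 1ℚ ℚ.+ 11/6 ℚ.* δ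
1-Fℚ≤1+ {z} {δ} 0≤δ h = 1-Fℚ≤ {z}
  (ℚ.+-mono-≤ {0ℚ} {1ℚ} (from-yes (0ℚ ℚ.≤? 1ℚ)) (*-monoʳ-≤-0≤ {0ℚ} {δ} 0≤11/6 0≤δ))
  (begin
    1ℚ ℚ.- (1ℚ ℚ.+ 11/6 ℚ.* δ)               ≡⟨ solve 1 (λ d → con 1ℚ :- (con 1ℚ :+ con 11/6 :* d) := con 11/6 :* con 0ℚ :- con 11/6 :* d) refl δ ⟩
    11/6 ℚ.* 0ℚ ℚ.- 11/6 ℚ.* δ               ≤⟨ ℚ.+-monoˡ-≤ (ℚ.- (11/6 ℚ.* δ)) (*-monoʳ-≤-0≤ 0≤11/6 h) ⟩
    11/6 ℚ.* (z ℚ.+ δ) ℚ.- 11/6 ℚ.* δ        ≡⟨ solve 2 (λ z d → con 11/6 :* (z :+ d) :- con 11/6 :* d := con 11/6 :* z) refl z δ ⟩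
    11/6 ℚ.* z                               ∎)

1-Fℚ≤0+ : ∀ {z δ} → 0ℚ ℚ.≤ δ → + 6 / 11 ℚ.≤ z ℚ.+ δ → 1-Fℚ z ℚ.≤ 11/6 ℚ.* δ
1-Fℚ≤0+ {z} {δ} 0≤δ h = 1-Fℚ≤ {z}
  (*-monoʳ-≤-0≤ {0ℚ} {δ} 0≤11/6 0≤δ)
  (begin
    11/6 ℚ.* (+ 6 / 11) ℚ.- 11/6 ℚ.* δ       ≤⟨ ℚ.+-monoˡ-≤ (ℚ.- (11/6 ℚ.* δ)) (*-monoʳ-≤-0≤ 0≤11/6 h) ⟩
    11/6 ℚ.* (z ℚ.+ δ) ℚ.- 11/6 ℚ.* δ        ≡⟨ solve 2 (λ z d → con 11/6 :* (z :+ d) :- con 11/6 :* d := con 11/6 :* z) refl z δ ⟩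
    11/6 ℚ.* z                               ∎)

-- Grouped by powers of c so that the upper bound needs the sign of c only.
∑∏-before : ℚ → ℚ → ℚ
∑∏-before u c = 2ℚ ℚ.+ u ℚ.+ (1ℚ ℚ.+ 2ℚ ℚ.* u) ℚ.* c

∑∏-before-≤ : ∀ {u c t} → t ℚ.≤ 1ℚ → u ℚ.≤ 1ℚ ℚ.+ t → 0ℚ ℚ.≤ c → c ℚ.≤ t →
              ∑∏-before u c ℚ.≤ 3ℚ ℚ.+ 6ℚ ℚ.* t
∑∏-before-≤ {u} {c} {t} t≤1 u≤1+t 0≤c c≤t = begin
  2ℚ ℚ.+ u ℚ.+ (1ℚ ℚ.+ 2ℚ ℚ.* u) ℚ.* c    ≤⟨ ℚ.+-mono-≤ (ℚ.+-monoʳ-≤ 2ℚ u≤1+t) (*-monoˡ-≤-0≤ 0≤c 1+2u≤5) ⟩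
  2ℚ ℚ.+ (1ℚ ℚ.+ t) ℚ.+ 5ℚ ℚ.* c          ≤⟨ ℚ.+-monoʳ-≤ (2ℚ ℚ.+ (1ℚ ℚ.+ t)) (*-monoʳ-≤-0≤ {c} {t} (from-yes (0ℚ ℚ.≤? 5ℚ)) c≤t) ⟩
  2ℚ ℚ.+ (1ℚ ℚ.+ t) ℚ.+ 5ℚ ℚ.* t          ≡⟨ solve 1 (λ t → con 2ℚ :+ (con 1ℚ :+ t) :+ con 5ℚ :* t := con 3ℚ :+ con 6ℚ :* t) refl t ⟩
  3ℚ ℚ.+ 6ℚ ℚ.* t                         ∎
  where
  1+2u≤5 : 1ℚ ℚ.+ 2ℚ ℚ.* u ℚ.≤ 5ℚ
  1+2u≤5 = ℚ.+-monoʳ-≤ 1ℚ (*-monoʳ-≤-0≤ {u} {2ℚ} (from-yes (0ℚ ℚ.≤? 2ℚ))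
    (ℚ.≤-trans u≤1+t (ℚ.+-monoʳ-≤ 1ℚ t≤1)))

*-∑∏-before-≤ : ∀ {p u c t} → 0ℚ ℚ.≤ p → p ℚ.≤ 11/6 →
                t ℚ.≤ 1ℚ → u ℚ.≤ 1ℚ ℚ.+ t → 0ℚ ℚ.≤ c → c ℚ.≤ t →
                p ℚ.* ∑∏-before u c ℚ.≤ 11/6 ℚ.* (3ℚ ℚ.+ 6ℚ ℚ.* t)
*-∑∏-before-≤ {p} {u} {c} {t} 0≤p p≤11/6 t≤1 u≤1+t 0≤c c≤t = begin
  p ℚ.* ∑∏-before u c             ≤⟨ *-monoʳ-≤-0≤ 0≤p (∑∏-before-≤ {u} {c} {t} t≤1 u≤1+t 0≤c c≤t) ⟩
  p ℚ.* (3ℚ ℚ.+ 6ℚ ℚ.* t)         ≤⟨ *-monoˡ-≤-0≤ 0≤3+6t p≤11/6 ⟩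
  11/6 ℚ.* (3ℚ ℚ.+ 6ℚ ℚ.* t)      ∎
  where
  0≤3+6t : 0ℚ ℚ.≤ 3ℚ ℚ.+ 6ℚ ℚ.* t
  0≤3+6t = ℚ.+-mono-≤ {0ℚ} {3ℚ} (from-yes (0ℚ ℚ.≤? 3ℚ))
    (*-monoʳ-≤-0≤ {0ℚ} {t} (from-yes (0ℚ ℚ.≤? 6ℚ)) (ℚ.≤-trans 0≤c c≤t))

0≤F′ : ∀ z (z≤? : Dec (z ≤ fromℚ (+ 6 / 11))) n → 0ℚ ℚ.≤ seq (F′ z z≤?) n
0≤F′ z (yes _) n = 0≤11/6
0≤F′ z (no  _) n = ℚ.≤-refl

F′≤11/6 : ∀ z (z≤? : Dec (z ≤ fromℚ (+ 6 / 11))) n → seq (F′ z z≤?) n ℚ.≤ 11/6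
F′≤11/6 z (yes _) n = ℚ.≤-refl
F′≤11/6 z (no  _) n = 0≤11/6

-- The six summands follow the order in which permutations 3 enumerates.
seq-d₃ : ∀ x₁ x₂ x₃ x₁≤? x₂≤? n →
  seq (d₃ x₁ x₂ x₃ x₁≤? x₂≤?) n ≡
  (+ 1 / 6) ℚ.* (seq (F′ x₁ x₁≤?) n ℚ.* ∑∏-before (1-Fℚ (seq x₂ n)) (1-Fℚ (seq x₃ n)) ℚ.+
                 seq (F′ x₂ x₂≤?) n ℚ.* ∑∏-before (1-Fℚ (seq x₁ n)) (1-Fℚ (seq x₃ n)))
seq-d₃ x₁ x₂ x₃ x₁≤? x₂≤? n = solve 5 (λ p q a b c →
    con (+ 1 / 6) :*
      (  (p :* :1               :+ q :* (a :* :1))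
      :+ ((p :* :1              :+ q :* (a :* (c :* :1)))
      :+ ((p :* (b :* :1)       :+ q :* :1)
      :+ ((p :* (c :* :1)       :+ q :* (a :* (c :* :1)))
      :+ ((p :* (b :* (c :* :1)) :+ q :* :1)
      :+ ((p :* (b :* (c :* :1)) :+ q :* (c :* :1))
      :+ con 0ℚ))))))
    := con (+ 1 / 6) :* (p :* before b c :+ q :* before a c))
  refl (seq (F′ x₁ x₁≤?) n) (seq (F′ x₂ x₂≤?) n)
       (1-Fℚ (seq x₁ n)) (1-Fℚ (seq x₂ n)) (1-Fℚ (seq x₃ n))
  where
  :1 : ∀ {k} → Polynomial k
  :1 = con 1ℚ
  before : ∀ {k} → Polynomial k → Polynomial k → Polynomial k
  before u c = con 2ℚ :+ u :+ (:1 :+ con 2ℚ :* u) :* c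

d₃-≤ : ∀ x₁ x₂ x₃ x₁≤? x₂≤? n {δ} → 0ℚ ℚ.≤ δ → δ ℚ.≤ + 6 / 11 →
  0ℚ ℚ.≤ seq x₁ n ℚ.+ δ → 0ℚ ℚ.≤ seq x₂ n ℚ.+ δ → + 6 / 11 ℚ.≤ seq x₃ n ℚ.+ δ →
  seq (d₃ x₁ x₂ x₃ x₁≤? x₂≤?) n ℚ.≤ 11/6 ℚ.+ (+ 121 / 18) ℚ.* δ
d₃-≤ x₁ x₂ x₃ x₁≤? x₂≤? n {δ} 0≤δ δ≤6/11 h₁ h₂ h₃ = begin
  seq (d₃ x₁ x₂ x₃ x₁≤? x₂≤?) n
    ≡⟨ seq-d₃ x₁ x₂ x₃ x₁≤? x₂≤? n ⟩
  (+ 1 / 6) ℚ.* (seq (F′ x₁ x₁≤?) n ℚ.* ∑∏-before b c ℚ.+ seq (F′ x₂ x₂≤?) n ℚ.* ∑∏-before a c)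
    ≤⟨ *-monoʳ-≤-0≤ (from-yes (0ℚ ℚ.≤? (+ 1 / 6)))
         (ℚ.+-mono-≤ (weighted x₁ x₁≤? x₂ h₂) (weighted x₂ x₂≤? x₁ h₁)) ⟩
  (+ 1 / 6) ℚ.* (11/6 ℚ.* (3ℚ ℚ.+ 6ℚ ℚ.* t) ℚ.+ 11/6 ℚ.* (3ℚ ℚ.+ 6ℚ ℚ.* t))
    ≡⟨ solve 1 (λ d → let s = con 11/6 :* (con 3ℚ :+ con 6ℚ :* (con 11/6 :* d)) in
         con (+ 1 / 6) :* (s :+ s) := con 11/6 :+ con (+ 121 / 18) :* d) refl δ ⟩
  11/6 ℚ.+ (+ 121 / 18) ℚ.* δ ∎
  where
  a = 1-Fℚ (seq x₁ n)
  b = 1-Fℚ (seq x₂ n)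
  c = 1-Fℚ (seq x₃ n)
  t = 11/6 ℚ.* δ
  weighted : ∀ y y≤? z → 0ℚ ℚ.≤ seq z n ℚ.+ δ →
    seq (F′ y y≤?) n ℚ.* ∑∏-before (1-Fℚ (seq z n)) c ℚ.≤ 11/6 ℚ.* (3ℚ ℚ.+ 6ℚ ℚ.* t)
  weighted y y≤? z h = *-∑∏-before-≤ (0≤F′ y y≤? n) (F′≤11/6 y y≤? n)
    (*-monoʳ-≤-0≤ {δ} {+ 6 / 11} 0≤11/6 δ≤6/11)
    (1-Fℚ≤1+ {seq z n} 0≤δ h) (0≤1-Fℚ (seq x₃ n)) (1-Fℚ≤0+ {seq x₃ n} 0≤δ h₃)

6/11≤1-x-y+δ : ∀ {x y δ} → x ℚ.+ y ℚ.≤ + 5 / 11 ℚ.+ δ → + 6 / 11 ℚ.≤ 1ℚ ℚ.- x ℚ.- y ℚ.+ δ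
6/11≤1-x-y+δ {x} {y} {δ} h = begin
  + 6 / 11                                          ≡⟨ solve 1 (λ d → con (+ 6 / 11) := con 1ℚ :- (con (+ 5 / 11) :+ d) :+ d) refl δ ⟩
  1ℚ ℚ.- (+ 5 / 11 ℚ.+ δ) ℚ.+ δ                     ≤⟨ ℚ.+-monoˡ-≤ δ (ℚ.+-monoʳ-≤ 1ℚ (ℚ.neg-antimono-≤ h)) ⟩
  1ℚ ℚ.- (x ℚ.+ y) ℚ.+ δ                            ≡⟨ solve 3 (λ x y d → con 1ℚ :- (x :+ y) :+ d := con 1ℚ :- x :- y :+ d) refl x y δ ⟩
  1ℚ ℚ.- x ℚ.- y ℚ.+ δ                              ∎

tolerance : ∀ {ε} → 0ℚ ℚ.< ε → ∃ λ δ → 0ℚ ℚ.< δ × δ ℚ.≤ + 6 / 11 × (+ 121 / 18) ℚ.* δ ℚ.≤ ε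
tolerance {ε} 0<ε = δ , 0<δ , ℚ.p⊓q≤q η (+ 6 / 11) , (begin
  (+ 121 / 18) ℚ.* δ                        ≤⟨ *-monoʳ-≤-0≤ (from-yes (0ℚ ℚ.≤? (+ 121 / 18))) (ℚ.p⊓q≤p η (+ 6 / 11)) ⟩
  (+ 121 / 18) ℚ.* ((+ 18 / 121) ℚ.* ε)     ≡⟨ solve 1 (λ e → con (+ 121 / 18) :* (con (+ 18 / 121) :* e) := e) refl ε ⟩
  ε                                         ∎)
  where
  η = (+ 18 / 121) ℚ.* ε
  δ = η ℚ.⊓ (+ 6 / 11)
  0<δ : 0ℚ ℚ.< δ
  0<δ with ℚ.⊓-sel η (+ 6 / 11)
  ... | inj₁ δ≡η    = subst (0ℚ ℚ.<_) (sym δ≡η) (ℚ.*-monoʳ-<-pos (+ 18 / 121) 0<ε)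
  ... | inj₂ δ≡6/11 = subst (0ℚ ℚ.<_) (sym δ≡6/11) (from-yes (0ℚ ℚ.<? (+ 6 / 11)))

fromℚ-mono-≤ : ∀ {p q} → p ℚ.≤ q → fromℚ p ≤ fromℚ q
fromℚ-mono-≤ {p} {q} p≤q ε 0<ε = 0 , λ _ _ → begin
  p         ≡⟨ ℚ.+-identityʳ p ⟨
  p ℚ.+ 0ℚ  ≤⟨ ℚ.+-mono-≤ p≤q (ℚ.<⇒≤ 0<ε) ⟩
  q ℚ.+ ε   ∎

lemma6p7 : (x₁ x₂ : ℝ) (x₁≤? : Dec (x₁ ≤ fromℚ (+ 6 / 11))) (x₂≤? : Dec (x₂ ≤ fromℚ (+ 6 / 11))) →
    0ℝ ≤ x₁ → 0ℝ ≤ x₂ → x₁ + x₂ ≤ fromℚ (+ 5 / 11) →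
    (C₃ x₁ x₂ x₁≤? x₂≤? ≤ fromℚ (+ 11 / 6)) × (fromℚ (+ 11 / 6) ≤ fromℚ (+ 2012096 / 1000000))
lemma6p7 x₁ x₂ x₁≤? x₂≤? 0≤x₁ 0≤x₂ x₁+x₂≤5/11 =
  C₃≤11/6 , fromℚ-mono-≤ (from-yes (11/6 ℚ.≤? (+ 2012096 / 1000000)))
  where
  C₃≤11/6 : C₃ x₁ x₂ x₁≤? x₂≤? ≤ fromℚ (+ 11 / 6)
  C₃≤11/6 ε 0<ε =
    let δ , 0<δ , δ≤6/11 , δ≤ε = tolerance 0<ε
        N₁ , h₁ = 0≤x₁ δ 0<δ
        N₂ , h₂ = 0≤x₂ δ 0<δ
        N₃ , h₃ = x₁+x₂≤5/11 δ 0<δ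
    in N₁ ℕ.⊔ N₂ ℕ.⊔ N₃ , λ n N≤n →
      let N₁⊔N₂≤n = ℕ.m⊔n≤o⇒m≤o (N₁ ℕ.⊔ N₂) N₃ N≤n in
      ℚ.≤-trans
        (d₃-≤ x₁ x₂ (1ℝ - x₁ - x₂) x₁≤? x₂≤? n (ℚ.<⇒≤ 0<δ) δ≤6/11
          (h₁ n (ℕ.m⊔n≤o⇒m≤o N₁ N₂ N₁⊔N₂≤n))
          (h₂ n (ℕ.m⊔n≤o⇒n≤o N₁ N₂ N₁⊔N₂≤n))
          (6/11≤1-x-y+δ {seq x₁ n} {seq x₂ n} (h₃ n (ℕ.m⊔n≤o⇒n≤o (N₁ ℕ.⊔ N₂) N₃ N≤n))))
        (ℚ.+-monoʳ-≤ 11/6 δ≤ε)
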